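{- Let $P(x,w)\subseteq[0,1]^{d_x}\times\mathbb{R}^{d_w}$ be a mixed integer polytope and let $\rho\ge 1$. For every $\rho$-approximate extended formulation $Q(x,w,y)$ of $P(x,w)$ with a mixed linear section, there is a translation $T[Q(x,w,y)]$ of $Q$ to mixed product relaxations (that is, a substitution $T$ such that $T[Q(x,w,y)]$ is a mixed product relaxation of $P(x,w)$) such that $$P(x,w)\subseteq \operatorname{proj}_{x,w}(T[Q(x,w,y)])\subseteq \operatorname{proj}_{x,w}(Q(x,w,y)).$$
   Context: A mixed integer polytope $P(x,w)\subseteq[0,1]^{d_x}\times\mathbb{R}^{d_w}$ is a polytope of the form $\operatorname{conv}(M)$ with $M\subseteq\{0,1\}^{d_x}\times\mathbb{R}^{d_w}$; the $x$ variables are integer ($0$-$1$), the $w$ variables fractional. Its mixed integer points are those in $P(x,w)\cap(\{0,1\}^{d_x}\times\mathbb{R}^{d_w})$. An extended relaxation of a polyhedron $P$ is a linear system whose projection to the original variables contains $P$. $\rho$-approximate extended formulation: Let $O$ be the given set of admissible objective vectors on the original variables $v=(x,w)$. An extended relaxation $Q(v,y)$ of $P$ is a $\rho$-approximate extended formulation if, for a maximization problem, $\max\{u^Tv\mid (v,y)\in Q\}\ge\max\{u^Tv\mid v\in P\}$ for all real vectors $u$ and $\max\{u^Tv\mid (v,y)\in Q\}\le\rho\max\{u^Tv\mid v\in P\}$ for all $u\in O$; for a minimization problem, $\min\{u^Tv\mid (v,y)\in Q\}\le\min\{u^Tv\mid v\in P\}$ for all real $u$ and $\min\{u^Tv\mid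 (v,y)\in Q\}\ge\rho^{ -1}\min\{u^Tv\mid v\in P\}$ for all $u\in O$. Mixed linear section: A section of $Q(x,w,y)$, $y\in\mathbb{R}^{d_y}$, is a function $g$ assigning to each mixed integer point $(x,w)$ of $P$ a point of $Q$ whose projection to the $(x,w)$ variables is $(x,w)$. It is mixed linear if for every $x'\in\{0,1\}^{d_x}$ and every $i=1,\dots,d_y$ its $y_i$-coordinate at $(x',w)$ is an affine function $g_i^{x'}(w)$ of $w$. $Q$ is an extended formulation with a mixed linear section if such a section exists. Mixed product relaxation: A mixed product relaxation $D(z)$ of $P(x,w)$ is an extended relaxation of $P(x,w)$ in variables $z\in\mathbb{R}^{(d_w+1)2^{d_x}-1}$, consisting of the variables $z_{\{w_j\}}=w_j$, $j=1,\dots,d_w$, and, for every nonempty $\mathcal E\subseteq\{x_1,\dots,x_{d_x}\}$, a variable $z_{\mathcal E}$ and variables $z_{\mathcal E w_j}$, $j=1,\dots,d_w$ (with $z_{\{x_i\}}$ identified with $x_i$), such that for every mixed integer point $(x,w)$ of $P$ the vector $f(x,w)$ with coordinates $f_{\mathcal E}(x,w)=\prod_{x_i\in\mathcal E}x_i$ and $f_{\mathcal E w_j}(x,w)=(\prod_{x_i\in\mathcal E}x_i)\,w_j$ (and coordinate $w_j$ at $z_{\{w_j\}}$) belongs to $D(z)$. Substitution and translation: A substitution $T$ expresses each $y_i$ as an affine function of the mixed product variables $z$; $T[Q(x,w,y)]$ is the linear system in $z$ obtained from the system defining $Q$ by substituting these expressions for the $y_i$ and the variables $z_{\{x_i\}},z_{\{w_j\}}$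 for $x_i,w_j$. If it is a mixed product relaxation of $P(x,w)$ it is called a translation of $Q$ to mixed product relaxations. $\operatorname{proj}_{x,w}$ denotes projection to the coordinates $x,w$. -}

module Defs where

open import Algebra.Apartness.Bundles using (HeytingField; HeytingCommutativeRing)
import Algebra.Definitions.RawMonoid as RawMonoidDefs
open import Algebra.Bundles using (CommutativeRing)
open import Data.Bool.Base using (Bool; if_then_else_)
open import Data.Empty using (⊥-elim)
open import Data.Fin.Base using (Fin)
open import Data.Fin.Subset using (Subset; ⁅_⁆; Nonempty) renaming (⊥ to ∅)
open import Data.Fin.Subset.Properties using (x∈⁅x⁆)
open import Data.List.Base using (List; []; _∷_; foldr; map; _++_)
open import Data.List.Relation.Unary.All using (All)
open import Data.Nat.Base as ℕ using (ℕ)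
open import Data.Product.Base using (Σ-syntax; ∃-syntax; _×_; _,_; proj₁)
open import Data.Sum.Base using (_⊎_; inj₁; inj₂)
open import Data.Vec.Base using (Vec; lookup)
open import Level using (Level; _⊔_) renaming (suc to lsuc)
open import Relation.Binary.Core using (Rel)
open import Relation.Binary.Structures using (IsStrictPartialOrder)
open import Relation.Nullary.Negation using (¬_)
open import Relation.Unary using (Pred; _∈_; _⊆_; _≐_)

private variable
  c ℓ₁ ℓ₂ ℓ₃ p m o : Level

-- The field of real numbers, given by axioms: a Cauchy-complete Archimedean
-- ordered field.  Classically these axioms characterise ℝ up to isomorphism.
-- They are phrased with an apartness relation and without decidability of the
-- order, so that constructively defined reals satisfy them as well.
record RealField c ℓ₁ ℓ₂ ℓ₃ : Set (lsuc (c ⊔ ℓ₁ ⊔ ℓ₂ ⊔ ℓ₃)) where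
  infix 4 _<_ _≤_
  field
    heytingField : HeytingField c ℓ₁ ℓ₂

  open HeytingField heytingField public
  open HeytingCommutativeRing heytingCommutativeRing public using (commutativeRing)
  open CommutativeRing commutativeRing public
    using (+-rawMonoid; *-rawMonoid)
  open RawMonoidDefs +-rawMonoid public using (sum) renaming (_×_ to _×ℕ_)
  open RawMonoidDefs *-rawMonoid public using () renaming (sum to product)

  field
    _<_                  : Rel Carrier ℓ₃
    isStrictPartialOrder : IsStrictPartialOrder _≈_ _<_
    #⇒<⊎>                : ∀ {a b} → a # b → a < b ⊎ b < a
    <⇒#                  : ∀ {a b} → a < b → a # b
    0<1                  : 0# < 1#
    +-monoˡ-<            : ∀ {a b} e → a < b → a + e < b + e
    *-pos                : ∀ {a b} → 0# < a → 0# < b → 0# < a * b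
    archimedean          : ∀ a → ∃[ n ] a < n ×ℕ 1#

  _≤_ : Rel Carrier ℓ₃
  a ≤ b = ¬ (b < a)

  _within_of_ : Carrier → Carrier → Carrier → Set ℓ₃
  a within ε of b = a - b < ε × b - a < ε

  field
    complete : (s : ℕ → Carrier) →
      (∀ ε → 0# < ε → ∃[ N ] ∀ k l → N ℕ.≤ k → N ℕ.≤ l → s k within ε of s l) →
      ∃[ a ] ∀ ε → 0# < ε → ∃[ N ] ∀ k → N ℕ.≤ k → s k within ε of a

data OrigVar (dx dw : ℕ) : Set where
  x : Fin dx → OrigVar dx dw
  w : Fin dw → OrigVar dx dw

data ExtVar (dx dw dy : ℕ) : Set where
  orig : OrigVar dx dw → ExtVar dx dw dy
  y    : Fin dy → ExtVar dx dw dy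

-- The mixed product variables: z E is z_E for nonempty E, and zw E j is
-- z_{E w_j} for arbitrary E, where zw ∅ j plays the role of z_{{w_j}}.
-- In total there are (2^dx - 1) + 2^dx * dw = (dw + 1) 2^dx - 1 of them.
data ProdVar (dx dw : ℕ) : Set where
  z  : (E : Subset dx) → .(Nonempty E) → ProdVar dx dw
  zw : Subset dx → Fin dw → ProdVar dx dw

origᶻ : ∀ {dx dw} → OrigVar dx dw → ProdVar dx dw
origᶻ (x i) = z ⁅ i ⁆ (i , x∈⁅x⁆ i)
origᶻ (w j) = zw ∅ j

data Sense : Set where
  maximize minimize : Sense

module Over (ℝ : RealField c ℓ₁ ℓ₂ ℓ₃) where
  open RealField ℝ public

  Assignment : Set → Set c
  Assignment V = V → Carrier

  Point : ℕ → ℕ → Set c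
  Point dx dw = Assignment (OrigVar dx dw)

  record Affine (V : Set) : Set c where
    constructor affine
    field
      const : Carrier
      terms : List (Carrier × V)

  open Affine public

  eval : ∀ {V} → Affine V → Assignment V → Carrier
  eval e s = const e + foldr (λ (a , v) r → a * s v + r) 0# (terms e)

  data Constraint (V : Set) : Set c where
    _≤ᶜ_ _≈ᶜ_ : Affine V → Affine V → Constraint V

  LinearSystem : Set → Set c
  LinearSystem V = List (Constraint V)

  _⊨_ : ∀ {V} → Assignment V → Constraint V → Set (ℓ₁ ⊔ ℓ₃)
  s ⊨ (e ≤ᶜ e′) = Level.Lift ℓ₁ (eval e s ≤ eval e′ s)
  s ⊨ (e ≈ᶜ e′) = Level.Lift ℓ₃ (eval e s ≈ eval e′ s)

  Solutions : ∀ {V} → LinearSystem V → Pred (Assignment V) (c ⊔ ℓ₁ ⊔ ℓ₃)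
  Solutions Q s = All (s ⊨_) Q

  -- ι tells which variables of the system are the original ones.
  proj : ∀ {V W : Set} → (V → W) → LinearSystem W → Pred (Assignment V) (c ⊔ ℓ₁ ⊔ ℓ₃)
  proj ι Q v = ∃[ s ] s ∈ Solutions Q × (∀ i → s (ι i) ≈ v i)

  IsExtendedRelaxation : ∀ {V W : Set} → (V → W) → LinearSystem W →
                         Pred (Assignment V) p → Set (c ⊔ ℓ₁ ⊔ ℓ₃ ⊔ p)
  IsExtendedRelaxation ι Q P = P ⊆ proj ι Q

  var : ∀ {V} → V → Affine V
  var v = affine 0# ((1# , v) ∷ [])

  _⊕_ : ∀ {V} → Affine V → Affine V → Affine V
  e ⊕ e′ = affine (const e + const e′) (terms e ++ terms e′)

  _⊛_ : ∀ {V} → Carrier → Affine V → Affine V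
  a ⊛ e = affine (a * const e) (map (λ (b , v) → (a * b , v)) (terms e))

  substAffine : ∀ {V W} → (V → Affine W) → Affine V → Affine W
  substAffine σ e = foldr (λ (a , v) r → (a ⊛ σ v) ⊕ r) (affine (const e) []) (terms e)

  substConstraint : ∀ {V W} → (V → Affine W) → Constraint V → Constraint W
  substConstraint σ (e ≤ᶜ e′) = substAffine σ e ≤ᶜ substAffine σ e′
  substConstraint σ (e ≈ᶜ e′) = substAffine σ e ≈ᶜ substAffine σ e′

  Substitution : ℕ → ℕ → ℕ → Set c
  Substitution dx dw dy = Fin dy → Affine (ProdVar dx dw)

  module _ {dx dw dy : ℕ} where

    replace : Substitution dx dw dy → ExtVar dx dw dy → Affine (ProdVar dx dw)
    replace T (orig v) = var (origᶻ v)
    replace T (y i)    = T i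

    _[_] : Substitution dx dw dy → LinearSystem (ExtVar dx dw dy) →
           LinearSystem (ProdVar dx dw)
    T [ Q ] = map (substConstraint (replace T)) Q

  conv : ∀ {V} → Pred (Assignment V) p → Pred (Assignment V) (c ⊔ ℓ₁ ⊔ ℓ₃ ⊔ p)
  conv M v =
    Σ[ n ∈ ℕ ] Σ[ coeff ∈ (Fin n → Carrier) ] Σ[ pt ∈ (Fin n → Assignment _) ]
      (∀ k → 0# ≤ coeff k) × sum coeff ≈ 1# × (∀ k → pt k ∈ M) ×
      (∀ i → v i ≈ sum (λ k → coeff k * pt k i))

  IsPolytope : ∀ {V} → Pred (Assignment V) p → Set (c ⊔ ℓ₁ ⊔ ℓ₃ ⊔ p)
  IsPolytope P = Σ[ n ∈ ℕ ] Σ[ vertex ∈ (Fin n → Assignment _) ]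
    P ≐ conv (λ v → ∃[ k ] ∀ i → v i ≈ vertex k i)

  bit : Bool → Carrier
  bit b = if b then 1# else 0#

  module _ {dx dw : ℕ} where

    HasIntegerPart : Vec Bool dx → Pred (Point dx dw) ℓ₁
    HasIntegerPart x′ v = ∀ i → v (x i) ≈ bit (lookup x′ i)

    MixedInteger : Pred (Point dx dw) ℓ₁
    MixedInteger v = ∃[ x′ ] HasIntegerPart x′ v

  record MixedIntegerPolytope (dx dw : ℕ) p m : Set (c ⊔ ℓ₁ ⊔ ℓ₃ ⊔ lsuc (p ⊔ m)) where
    field
      points     : Pred (Point dx dw) p
      inCube     : ∀ {v} → v ∈ points → ∀ i → 0# ≤ v (x i) × v (x i) ≤ 1#
      isPolytope : IsPolytope points
      generators : Pred (Point dx dw) m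
      integral   : generators ⊆ MixedInteger
      isHull     : points ≐ conv generators

  open MixedIntegerPolytope public using (points)

  record MixedIntegerPoint {dx dw} (P : MixedIntegerPolytope dx dw p m) :
         Set (c ⊔ ℓ₁ ⊔ p) where
    field
      point          : Point dx dw
      isMember       : point ∈ points P
      isMixedInteger : point ∈ MixedInteger

  open MixedIntegerPoint public

  data Extended : Set c where
    -∞ +∞ : Extended
    fin   : Carrier → Extended

  data _≤∞_ : Rel Extended (c ⊔ ℓ₃) where
    -∞≤  : ∀ {e} → -∞ ≤∞ e
    ≤+∞  : ∀ {e} → e ≤∞ +∞
    fin≤ : ∀ {a b} → a ≤ b → fin a ≤∞ fin b

  -- Only meant for positive real factors.
  _·∞_ : Carrier → Extended → Extended
  a ·∞ -∞    = -∞
  a ·∞ +∞    = +∞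
  a ·∞ fin b = fin (a * b)

  -- Linear programming conventions: an unbounded maximum is +∞, a maximum over
  -- the empty set is -∞, and dually for minima.
  IsMax : Pred Carrier p → Extended → Set (c ⊔ ℓ₃ ⊔ p)
  IsMax {p} S -∞      = Level.Lift (ℓ₃ ⊔ c ⊔ p) (∀ a → ¬ (a ∈ S))
  IsMax {p} S +∞      = ∀ b → ∃[ a ] a ∈ S × b < a
  IsMax {p} S (fin a) = a ∈ S × (∀ b → b ∈ S → b ≤ a)

  IsMin : Pred Carrier p → Extended → Set (c ⊔ ℓ₃ ⊔ p)
  IsMin {p} S -∞      = ∀ b → ∃[ a ] a ∈ S × a < b
  IsMin {p} S +∞      = Level.Lift (ℓ₃ ⊔ c ⊔ p) (∀ a → ¬ (a ∈ S))
  IsMin {p} S (fin a) = a ∈ S × (∀ b → b ∈ S → a ≤ b)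

  1≤⇒#0 : ∀ {ρ} → 1# ≤ ρ → ρ # 0#
  1≤⇒#0 {ρ} 1≤ρ with #-cotrans (#-sym (<⇒# 0<1)) ρ
  ... | inj₂ ρ#0 = ρ#0
  ... | inj₁ 1#ρ with #⇒<⊎> 1#ρ
  ...   | inj₁ 1<ρ = #-sym (<⇒# (IsStrictPartialOrder.trans isStrictPartialOrder 0<1 1<ρ))
  ...   | inj₂ ρ<1 = ⊥-elim (1≤ρ ρ<1)

  -- The library's inverse is an inverse of ρ - 0#, which is ρ.
  reciprocal : ∀ ρ → 1# ≤ ρ → Carrier
  reciprocal ρ 1≤ρ = proj₁ (#⇒invertible (1≤⇒#0 1≤ρ))

  module _ {dx dw : ℕ} where

    infix 8 _∙_
    _∙_ : Point dx dw → Point dx dw → Carrier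
    u ∙ v = sum (λ i → u (x i) * v (x i)) + sum (λ j → u (w j) * v (w j))

    values : Point dx dw → Pred (Point dx dw) p → Pred Carrier (c ⊔ ℓ₁ ⊔ p)
    values u S a = ∃[ v ] v ∈ S × a ≈ u ∙ v

  module _ {dx dw dy : ℕ} where

    -- The values of uᵀv over (v , y) ∈ Q are those over v ∈ proj orig Q.  The
    -- optima a of Q and b of P are the unique values with the stated property.
    SatisfiesApproximationBounds :
      Sense → Pred (Point dx dw) o → (ρ : Carrier) → 1# ≤ ρ →
      LinearSystem (ExtVar dx dw dy) → Pred (Point dx dw) p → Set (c ⊔ ℓ₁ ⊔ ℓ₃ ⊔ o ⊔ p)
    SatisfiesApproximationBounds maximize O ρ 1≤ρ Q P =
      (∀ u a b → IsMax (values u (proj orig Q)) a → IsMax (values u P) b → b ≤∞ a) ×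
      (∀ u → u ∈ O → ∀ a b →
         IsMax (values u (proj orig Q)) a → IsMax (values u P) b → a ≤∞ (ρ ·∞ b))
    SatisfiesApproximationBounds minimize O ρ 1≤ρ Q P =
      (∀ u a b → IsMin (values u (proj orig Q)) a → IsMin (values u P) b → a ≤∞ b) ×
      (∀ u → u ∈ O → ∀ a b →
         IsMin (values u (proj orig Q)) a → IsMin (values u P) b →
         (reciprocal ρ 1≤ρ ·∞ b) ≤∞ a)

    IsApproximateExtendedFormulation :
      Sense → Pred (Point dx dw) o → (ρ : Carrier) → 1# ≤ ρ →
      LinearSystem (ExtVar dx dw dy) → Pred (Point dx dw) p → Set (c ⊔ ℓ₁ ⊔ ℓ₃ ⊔ o ⊔ p)
    IsApproximateExtendedFormulation sense O ρ 1≤ρ Q P =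
      IsExtendedRelaxation orig Q P × SatisfiesApproximationBounds sense O ρ 1≤ρ Q P

    module _ (P : MixedIntegerPolytope dx dw p m) where

      IsSection : LinearSystem (ExtVar dx dw dy) →
                  (MixedIntegerPoint P → Assignment (ExtVar dx dw dy)) → Set (c ⊔ ℓ₁ ⊔ ℓ₃ ⊔ p)
      IsSection Q g = ∀ a → g a ∈ Solutions Q × (∀ i → g a (orig i) ≈ point a i)

      IsMixedLinear : (MixedIntegerPoint P → Assignment (ExtVar dx dw dy)) → Set (c ⊔ ℓ₁ ⊔ p)
      IsMixedLinear g = ∀ (x′ : Vec Bool dx) (i : Fin dy) →
        Σ[ h ∈ Affine (Fin dw) ] ∀ a → HasIntegerPart x′ (point a) →
          g a (y i) ≈ eval h (λ j → point a (w j))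

      HasMixedLinearSection : LinearSystem (ExtVar dx dw dy) → Set (c ⊔ ℓ₁ ⊔ ℓ₃ ⊔ p)
      HasMixedLinearSection Q = ∃[ g ] IsSection Q g × IsMixedLinear g

  module _ {dx dw : ℕ} where

    ∏ : Subset dx → Point dx dw → Carrier
    ∏ E v = product (λ i → if lookup E i then v (x i) else 1#)

    mixedProducts : Point dx dw → Assignment (ProdVar dx dw)
    mixedProducts v (z E _)  = ∏ E v
    mixedProducts v (zw E j) = ∏ E v * v (w j)

    IsMixedProductRelaxation :
      LinearSystem (ProdVar dx dw) → MixedIntegerPolytope dx dw p m → Set (c ⊔ ℓ₁ ⊔ ℓ₃ ⊔ p)
    IsMixedProductRelaxation D P =
      IsExtendedRelaxation origᶻ D (points P) ×
      (∀ (a : MixedIntegerPoint P) → mixedProducts (point a) ∈ Solutions D)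

    IsTranslation : ∀ {dy} → Substitution dx dw dy → LinearSystem (ExtVar dx dw dy) →
                    MixedIntegerPolytope dx dw p m → Set (c ⊔ ℓ₁ ⊔ ℓ₃ ⊔ p)
    IsTranslation T Q P = IsMixedProductRelaxation (T [ Q ]) P

{-# OPTIONS --safe #-}
-- For x′ ∈ {0,1}^dx, the multilinear polynomial ∏_{x′ᵢ=1} xᵢ · ∏_{x′ᵢ=0} (1 - xᵢ)
-- is the indicator of x′ on 0-1 vectors.  Multiplying the affine functions
-- g_i^{x′}(w) by these indicators, expanding, and summing over x′ gives a
-- polynomial in (x , w) whose monomials are mixed products, so replacing each
-- mixed product by its variable yields the substitution T for yᵢ.  At f(x , w) the
-- substituted yᵢ is the section's yᵢ, hence f(x , w) solves T[Q].  A point of P is a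
-- convex combination of mixed integer points, and the same combination of their
-- images under f solves T[Q] and projects to it.  Conversely, a solution s of T[Q]
-- gives the solution (s_x , s_w , T(s)) of Q with the same projection.
module Submission where

open import Defs
open import Algebra.Bundles using (CommutativeRing)
import Algebra.Properties.Group as GroupProperties
import Algebra.Properties.CommutativeSemigroup as CommutativeSemigroupProperties
import Algebra.Properties.Monoid.Sum as MonoidSum
import Algebra.Properties.Ring as RingProperties
import Algebra.Properties.Semiring.Sum as SemiringSum
open import Data.Bool.Base using (Bool; true; false; if_then_else_)
open import Data.Fin.Base using (Fin; zero; suc)
open import Data.Fin.Subset using (Subset; ⁅_⁆; Nonempty) renaming (⊥ to ∅)
open import Data.Fin.Subset.Properties using (nonempty?; ∉⊥)
open import Data.List.Base using (List; []; _∷_; map; _++_)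
open import Data.List.Relation.Unary.All as All using ([]; _∷_)
import Data.List.Relation.Unary.All.Properties as All
open import Data.Nat.Base using (ℕ; zero; suc)
open import Data.Product.Base using (Σ-syntax; _×_; _,_; proj₁; proj₂)
open import Data.Sum.Base using (inj₁; inj₂)
open import Data.Vec.Base using (Vec; []; _∷_; lookup)
open import Data.Vec.Properties using (lookup⇒[]=)
open import Function.Base using (_∘_; id)
open import Level using (Level; lift; lower)
import Relation.Binary.Reasoning.Setoid as ≈-Reasoning
open import Relation.Binary.Structures using (IsStrictPartialOrder)
open import Relation.Nullary.Decidable using (yes; no)
open import Relation.Nullary.Negation using (¬_; contradiction)
open import Relation.Unary using (Pred; _∈_; _⊆_)

module _ {c ℓ₁ ℓ₂ ℓ₃} (ℝ : RealField c ℓ₁ ℓ₂ ℓ₃) where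
  open Over ℝ hiding (zero)
  open CommutativeRing commutativeRing
    using (ring; semiring; +-group; +-commutativeSemigroup; *-commutativeSemigroup; *-monoid)
  open GroupProperties +-group using (//-rightDividesˡ; //-rightDividesʳ)
  open CommutativeSemigroupProperties +-commutativeSemigroup using (interchange)
  open CommutativeSemigroupProperties *-commutativeSemigroup using (x∙yz≈y∙xz)
  open RingProperties ring using (-1*x≈-x)
  open SemiringSum semiring
    using (sum-cong-≋; ∑-distrib-+; *-distribˡ-sum; *-distribʳ-sum)
  open MonoidSum *-monoid using ()
    renaming (sum-cong-≋ to product-cong; sum-replicate-zero to product-replicate-one)
  private module < = IsStrictPartialOrder isStrictPartialOrder
  open ≈-Reasoning setoid

  private variable
    V W : Set

  -- Order

  ≤-resp-≈ : ∀ {a a′ b b′} → a ≈ a′ → b ≈ b′ → a ≤ b → a′ ≤ b′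
  ≤-resp-≈ a≈a′ b≈b′ a≤b b′<a′ =
    a≤b (<.<-respˡ-≈ (sym b≈b′) (<.<-respʳ-≈ (sym a≈a′) b′<a′))

  ≤-reflexive : ∀ {a b} → a ≈ b → a ≤ b
  ≤-reflexive a≈b b<a = <.irrefl (sym a≈b) b<a

  -- `≤` is only a negation, so the strict conclusion has to come from apartness: cotransitivity
  -- puts `a` apart from `b` or from `d`, and `a ≤ b` excludes the wrong order in either case.
  ≤-<-trans : ∀ {a b d} → a ≤ b → b < d → a < d
  ≤-<-trans {a} a≤b b<d with #-cotrans (<⇒# b<d) a
  ... | inj₁ b#a with #⇒<⊎> b#a
  ...   | inj₁ b<a = contradiction b<a a≤b
  ...   | inj₂ a<b = <.trans a<b b<d
  ≤-<-trans a≤b b<d | inj₂ a#d with #⇒<⊎> a#d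
  ...   | inj₁ a<d = a<d
  ...   | inj₂ d<a = contradiction (<.trans b<d d<a) a≤b

  ≤-trans : ∀ {a b d} → a ≤ b → b ≤ d → a ≤ d
  ≤-trans a≤b b≤d d<a = a≤b (≤-<-trans b≤d d<a)

  +-cancelʳ-< : ∀ {a b} e → a + e < b + e → a < b
  +-cancelʳ-< {a} {b} e a+e<b+e =
    <.<-respˡ-≈ (//-rightDividesʳ e a) (<.<-respʳ-≈ (//-rightDividesʳ e b) (+-monoˡ-< (- e) a+e<b+e))

  +-monoˡ-≤ : ∀ {a b} e → a ≤ b → a + e ≤ b + e
  +-monoˡ-≤ e a≤b b+e<a+e = a≤b (+-cancelʳ-< e b+e<a+e)

  +-mono-≤ : ∀ {a b d e} → a ≤ b → d ≤ e → a + d ≤ b + e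
  +-mono-≤ {a} {b} {d} {e} a≤b d≤e =
    ≤-trans (+-monoˡ-≤ d a≤b) (≤-resp-≈ (+-comm d b) (+-comm e b) (+-monoˡ-≤ b d≤e))

  *-monoʳ-< : ∀ {a b d} → 0# < d → a < b → d * a < d * b
  *-monoʳ-< {a} {b} {d} 0<d a<b =
    <.<-respˡ-≈ (+-identityˡ _) (<.<-respʳ-≈ cancel (+-monoˡ-< (d * a) (*-pos 0<d 0<b-a)))
    where
    0<b-a : 0# < b - a
    0<b-a = <.<-respˡ-≈ (-‿inverseʳ a) (+-monoˡ-< (- a) a<b)
    cancel : d * (b - a) + d * a ≈ d * b
    cancel = trans (sym (distribˡ d (b - a) a)) (*-congˡ (//-rightDividesˡ a b))

  -- The conclusion is negative, so tightness of # stands in for deciding d ≈ 0 and a ≈ b.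
  *-monoʳ-≤ : ∀ {a b d} → 0# ≤ d → a ≤ b → d * a ≤ d * b
  *-monoʳ-≤ {a} {b} {d} 0≤d a≤b db<da = <.irrefl (trans (d*e≈0 b) (sym (d*e≈0 a))) db<da
    where
    ¬d#0 : ¬ d # 0#
    ¬d#0 d#0 with #⇒<⊎> d#0
    ... | inj₁ d<0 = 0≤d d<0
    ... | inj₂ 0<d = <.irrefl (*-congˡ (sym (proj₁ (tight a b) ¬a#b))) db<da
      where
      ¬a#b : ¬ a # b
      ¬a#b a#b with #⇒<⊎> a#b
      ... | inj₁ a<b = <.asym db<da (*-monoʳ-< 0<d a<b)
      ... | inj₂ b<a = a≤b b<a
    d*e≈0 : ∀ e → d * e ≈ 0#
    d*e≈0 e = trans (*-congʳ (proj₁ (tight d 0#) ¬d#0)) (zeroˡ e)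

  sum-mono-≤ : ∀ {n} {s t : Fin n → Carrier} → (∀ k → s k ≤ t k) → sum s ≤ sum t
  sum-mono-≤ {zero}  s≤t = ≤-reflexive refl
  sum-mono-≤ {suc n} s≤t = +-mono-≤ (s≤t zero) (sum-mono-≤ (s≤t ∘ suc))

  -- Affine expressions

  -- Inductions run over the list of terms, with the constant split off by `eval-linear`. As an
  -- instance of `eval`, the value carries a leading `0# +`, which `linear-∷` absorbs.
  linear : List (Carrier × V) → Assignment V → Carrier
  linear ts = eval (affine 0# ts)

  eval-linear : ∀ (e : Affine V) s → eval e s ≈ const e + linear (terms e) s
  eval-linear e s = +-congˡ (sym (+-identityˡ _))

  linear-∷ : ∀ a (v : V) ts s → linear ((a , v) ∷ ts) s ≈ a * s v + linear ts s
  linear-∷ a v ts s = trans (+-identityˡ _) (+-congˡ (sym (+-identityˡ _)))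

  linear-cong : ∀ (ts : List (Carrier × V)) {s t} → (∀ v → s v ≈ t v) → linear ts s ≈ linear ts t
  linear-cong []             s≈t = refl
  linear-cong ((a , v) ∷ ts) s≈t =
    -- The tail of the unfolded sum is the bare fold, so the induction hypothesis is stripped of its
    -- leading `0#` on both sides.
    +-congˡ (+-cong (*-congˡ (s≈t v)) (trans (sym (+-identityˡ _)) (trans (linear-cong ts s≈t) (+-identityˡ _))))

  eval-cong : ∀ (e : Affine V) {s t} → (∀ v → s v ≈ t v) → eval e s ≈ eval e t
  eval-cong e {s} {t} s≈t =
    trans (eval-linear e s) (trans (+-congˡ (linear-cong (terms e) s≈t)) (sym (eval-linear e t)))

  eval-var : ∀ (v : V) s → eval (var v) s ≈ s v
  eval-var v s = trans (+-identityˡ _) (trans (+-identityʳ _) (*-identityˡ _))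

  linear-++ : ∀ (ts us : List (Carrier × V)) s → linear (ts ++ us) s ≈ linear ts s + linear us s
  linear-++ []             us s = sym (trans (+-congʳ (+-identityˡ 0#)) (+-identityˡ _))
  linear-++ ((a , v) ∷ ts) us s = begin
    linear ((a , v) ∷ ts ++ us) s              ≈⟨ linear-∷ a v (ts ++ us) s ⟩
    a * s v + linear (ts ++ us) s              ≈⟨ +-congˡ (linear-++ ts us s) ⟩
    a * s v + (linear ts s + linear us s)      ≈⟨ +-assoc _ _ _ ⟨
    (a * s v + linear ts s) + linear us s      ≈⟨ +-congʳ (linear-∷ a v ts s) ⟨
    linear ((a , v) ∷ ts) s + linear us s      ∎

  eval-⊕ : ∀ (e e′ : Affine V) s → eval (e ⊕ e′) s ≈ eval e s + eval e′ s
  eval-⊕ e e′ s = begin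
    eval (e ⊕ e′) s                                                       ≈⟨ eval-linear (e ⊕ e′) s ⟩
    (const e + const e′) + linear (terms e ++ terms e′) s                 ≈⟨ +-congˡ (linear-++ (terms e) (terms e′) s) ⟩
    (const e + const e′) + (linear (terms e) s + linear (terms e′) s)     ≈⟨ interchange _ _ _ _ ⟩
    (const e + linear (terms e) s) + (const e′ + linear (terms e′) s)     ≈⟨ +-cong (eval-linear e s) (eval-linear e′ s) ⟨
    eval e s + eval e′ s                                                  ∎

  -- Covers two uses at once: scaling the coefficients by `q` with the variables fixed (`eval-⊛`),
  -- and renaming `w j` to `zw E j`, where `q` is the product over `E` (`eval-times`).
  linear-reindex : ∀ (q : Carrier) (f : Carrier × V → Carrier × W) {s t} →
                   (∀ b v → proj₁ (f (b , v)) * t (proj₂ (f (b , v))) ≈ q * (b * s v)) →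
                   ∀ ts → linear (map f ts) t ≈ q * linear ts s
  linear-reindex q f         f≈ []             = trans (+-identityˡ 0#) (sym (trans (*-congˡ (+-identityˡ 0#)) (zeroʳ q)))
  linear-reindex q f {s} {t} f≈ ((b , v) ∷ ts) = begin
    linear (map f ((b , v) ∷ ts)) t         ≈⟨ linear-∷ _ _ (map f ts) t ⟩
    _ + linear (map f ts) t                 ≈⟨ +-cong (f≈ b v) (linear-reindex q f f≈ ts) ⟩
    q * (b * s v) + q * linear ts s         ≈⟨ distribˡ q _ _ ⟨
    q * (b * s v + linear ts s)             ≈⟨ *-congˡ (linear-∷ b v ts s) ⟨
    q * linear ((b , v) ∷ ts) s             ∎

  eval-⊛ : ∀ a (e : Affine V) s → eval (a ⊛ e) s ≈ a * eval e s
  eval-⊛ a e s = begin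
    eval (a ⊛ e) s                               ≈⟨ eval-linear (a ⊛ e) s ⟩
    a * const e + linear (terms (a ⊛ e)) s       ≈⟨ +-congˡ (linear-reindex a _ (λ b v → *-assoc a b (s v)) (terms e)) ⟩
    a * const e + a * linear (terms e) s         ≈⟨ distribˡ a _ _ ⟨
    a * (const e + linear (terms e) s)           ≈⟨ *-congˡ (eval-linear e s) ⟨
    a * eval e s                                 ∎

  eval-substAffine : ∀ (σ : V → Affine W) (e : Affine V) s →
                     eval (substAffine σ e) s ≈ eval e (λ v → eval (σ v) s)
  eval-substAffine σ e s = go (terms e)
    where
    -- `substAffine` adds the constant at the far end of the fold, `eval` in front, so each step
    -- moves one term past the constant.
    go : ∀ ts → eval (substAffine σ (affine (const e) ts)) s ≈
                   eval (affine (const e) ts) (λ v → eval (σ v) s)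
    go []             = refl
    go ((a , v) ∷ ts) = begin
      eval ((a ⊛ σ v) ⊕ r) s                         ≈⟨ eval-⊕ (a ⊛ σ v) r s ⟩
      eval (a ⊛ σ v) s + eval r s                    ≈⟨ +-cong (eval-⊛ a (σ v) s) (go ts) ⟩
      a * eval (σ v) s + eval (affine (const e) ts) t ≈⟨ +-congˡ (eval-linear (affine (const e) ts) t) ⟩
      a * t v + (const e + linear ts t)              ≈⟨ +-assoc _ _ _ ⟨
      (a * t v + const e) + linear ts t              ≈⟨ +-congʳ (+-comm _ _) ⟩
      (const e + a * t v) + linear ts t              ≈⟨ +-assoc _ _ _ ⟩
      const e + (a * t v + linear ts t)              ≈⟨ +-congˡ (linear-∷ a v ts t) ⟨
      const e + linear ((a , v) ∷ ts) t              ≈⟨ eval-linear (affine (const e) ((a , v) ∷ ts)) t ⟨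
      eval (affine (const e) ((a , v) ∷ ts)) t       ∎
      where
      r = substAffine σ (affine (const e) ts)
      t = λ u → eval (σ u) s

  module _ {n} (coeff : Fin n → Carrier) (pt : Fin n → Assignment V) where

    combination : Assignment V
    combination v = sum (λ k → coeff k * pt k v)

    linear-combination : ∀ ts → linear ts combination ≈ sum (λ k → coeff k * linear ts (pt k))
    linear-combination [] = begin
      0# + 0#                                ≈⟨ +-identityˡ 0# ⟩
      0#                                     ≈⟨ zeroʳ (sum coeff) ⟨
      sum coeff * 0#                         ≈⟨ *-congˡ (+-identityˡ 0#) ⟨
      sum coeff * (0# + 0#)                  ≈⟨ *-distribʳ-sum (0# + 0#) coeff ⟩
      sum (λ k → coeff k * (0# + 0#))        ∎
    linear-combination ((a , v) ∷ ts) = begin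
      linear ((a , v) ∷ ts) combination
        ≈⟨ linear-∷ a v ts combination ⟩
      a * combination v + linear ts combination
        ≈⟨ +-cong (*-distribˡ-sum a (λ k → coeff k * pt k v)) (linear-combination ts) ⟩
      sum (λ k → a * (coeff k * pt k v)) + sum (λ k → coeff k * linear ts (pt k))
        ≈⟨ ∑-distrib-+ (λ k → a * (coeff k * pt k v)) (λ k → coeff k * linear ts (pt k)) ⟨
      sum (λ k → a * (coeff k * pt k v) + coeff k * linear ts (pt k))
        ≈⟨ sum-cong-≋ (λ k → trans (+-congʳ (x∙yz≈y∙xz a (coeff k) (pt k v))) (sym (distribˡ (coeff k) _ _))) ⟩
      sum (λ k → coeff k * (a * pt k v + linear ts (pt k)))
        ≈⟨ sum-cong-≋ (λ k → *-congˡ (linear-∷ a v ts (pt k))) ⟨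
      sum (λ k → coeff k * linear ((a , v) ∷ ts) (pt k)) ∎

    -- The linear part commutes with any weighted sum; the constant is spread over the points
    -- because the weights sum to 1.
    eval-combination : sum coeff ≈ 1# → ∀ e →
                       eval e combination ≈ sum (λ k → coeff k * eval e (pt k))
    eval-combination sum≈1 e = begin
      eval e combination
        ≈⟨ eval-linear e combination ⟩
      const e + linear (terms e) combination
        ≈⟨ +-cong (trans (sym (*-identityˡ _)) (*-congʳ (sym sum≈1))) (linear-combination (terms e)) ⟩
      sum coeff * const e + sum (λ k → coeff k * linear (terms e) (pt k))
        ≈⟨ +-congʳ (*-distribʳ-sum (const e) coeff) ⟩
      sum (λ k → coeff k * const e) + sum (λ k → coeff k * linear (terms e) (pt k))
        ≈⟨ ∑-distrib-+ (λ k → coeff k * const e) (λ k → coeff k * linear (terms e) (pt k)) ⟨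
      sum (λ k → coeff k * const e + coeff k * linear (terms e) (pt k))
        ≈⟨ sum-cong-≋ (λ k → trans (sym (distribˡ (coeff k) _ _)) (*-congˡ (sym (eval-linear e (pt k))))) ⟩
      sum (λ k → coeff k * eval e (pt k)) ∎

  -- Linear systems

  Solutions-resp-≈ : ∀ (Q : LinearSystem V) {s t} → (∀ v → s v ≈ t v) →
                     s ∈ Solutions Q → t ∈ Solutions Q
  Solutions-resp-≈ Q {s} {t} s≈t = All.map (λ {C} → resp C)
    where
    resp : ∀ C → s ⊨ C → t ⊨ C
    resp (e ≤ᶜ e′) (lift p) = lift (≤-resp-≈ (eval-cong e s≈t) (eval-cong e′ s≈t) p)
    resp (e ≈ᶜ e′) (lift p) = lift (trans (sym (eval-cong e s≈t)) (trans p (eval-cong e′ s≈t)))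

  module _ (σ : V → Affine W) (Q : LinearSystem V) {s : Assignment W} where

    private
      eval-σ : ∀ e → eval (substAffine σ e) s ≈ eval e (λ v → eval (σ v) s)
      eval-σ e = eval-substAffine σ e s

    -- This direction places mixed products in the translated system; the converse below recovers
    -- solutions of the original system from those of the translated one.
    Solutions-subst⁺ : (λ v → eval (σ v) s) ∈ Solutions Q → s ∈ Solutions (map (substConstraint σ) Q)
    Solutions-subst⁺ = All.map⁺ ∘ All.map (λ {C} → subst⁺ C)
      where
      subst⁺ : ∀ C → (λ v → eval (σ v) s) ⊨ C → s ⊨ substConstraint σ C
      subst⁺ (e ≤ᶜ e′) (lift p) = lift (≤-resp-≈ (sym (eval-σ e)) (sym (eval-σ e′)) p)
      subst⁺ (e ≈ᶜ e′) (lift p) = lift (trans (eval-σ e) (trans p (sym (eval-σ e′))))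

    Solutions-subst⁻ : s ∈ Solutions (map (substConstraint σ) Q) → (λ v → eval (σ v) s) ∈ Solutions Q
    Solutions-subst⁻ = All.map (λ {C} → subst⁻ C) ∘ All.map⁻
      where
      subst⁻ : ∀ C → s ⊨ substConstraint σ C → (λ v → eval (σ v) s) ⊨ C
      subst⁻ (e ≤ᶜ e′) (lift p) = lift (≤-resp-≈ (eval-σ e) (eval-σ e′) p)
      subst⁻ (e ≈ᶜ e′) (lift p) = lift (trans (sym (eval-σ e)) (trans p (eval-σ e′)))

  -- Both sides of a constraint are affine, so each evaluates to the weighted sum of its values at
  -- the points; nonnegative weights preserve inequalities term by term.
  Solutions-convex : ∀ (Q : LinearSystem V) {n} {coeff : Fin n → Carrier} {pt : Fin n → Assignment V} →
                     (∀ k → 0# ≤ coeff k) → sum coeff ≈ 1# → (∀ k → pt k ∈ Solutions Q) →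
                     combination coeff pt ∈ Solutions Q
  Solutions-convex []      coeff≥0 sum≈1 pt∈ = []
  Solutions-convex (C ∷ Q) {coeff = coeff} {pt} coeff≥0 sum≈1 pt∈ =
    convex C (All.head ∘ pt∈) ∷ Solutions-convex Q coeff≥0 sum≈1 (All.tail ∘ pt∈)
    where
    eval-Σ : ∀ e → eval e (combination coeff pt) ≈ sum (λ k → coeff k * eval e (pt k))
    eval-Σ = eval-combination coeff pt sum≈1
    convex : ∀ C → (∀ k → pt k ⊨ C) → combination coeff pt ⊨ C
    convex (e ≤ᶜ e′) p = lift (≤-resp-≈ (sym (eval-Σ e)) (sym (eval-Σ e′))
      (sum-mono-≤ (λ k → *-monoʳ-≤ (coeff≥0 k) (lower (p k)))))
    convex (e ≈ᶜ e′) p = lift (trans (eval-Σ e)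
      (trans (sum-cong-≋ (λ k → *-congˡ (lower (p k)))) (sym (eval-Σ e′))))

  -- Mixed products

  -- `∏ E v` is definitionally `monomial E (v ∘ x)`; freeing the dimension from `Point` permits
  -- induction on it.
  monomial : ∀ {n} → Subset n → (Fin n → Carrier) → Carrier
  monomial E t = product (λ i → if lookup E i then t i else 1#)

  monomial-empty : ∀ {n} (E : Subset n) t → ¬ Nonempty E → monomial E t ≈ 1#
  monomial-empty {n} E t E-empty = trans (product-cong factor) (product-replicate-one n)
    where
    factor : ∀ i → (if lookup E i then t i else 1#) ≈ 1#
    factor i with lookup E i in eq
    ... | true  = contradiction (i , lookup⇒[]= i E eq) E-empty
    ... | false = refl

  monomial-∅ : ∀ {n} (t : Fin n → Carrier) → monomial ∅ t ≈ 1#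
  monomial-∅ t = monomial-empty ∅ t (λ (_ , i∈∅) → ∉⊥ i∈∅)

  monomial-⁅⁆ : ∀ {n} (i : Fin n) t → monomial ⁅ i ⁆ t ≈ t i
  monomial-⁅⁆ zero    t = trans (*-congˡ (monomial-∅ (t ∘ suc))) (*-identityʳ _)
  monomial-⁅⁆ (suc i) t = trans (*-identityˡ _) (monomial-⁅⁆ i (t ∘ suc))

  module _ {dx dw : ℕ} where

    mixedProducts-orig : ∀ (v : Point dx dw) i → mixedProducts v (origᶻ i) ≈ v i
    mixedProducts-orig v (x i) = monomial-⁅⁆ i (v ∘ x)
    mixedProducts-orig v (w j) = trans (*-congʳ (monomial-∅ (v ∘ x))) (*-identityˡ _)

    -- z_∅ is not a variable: it stands for the constant 1.
    times : Subset dx → Affine (Fin dw) → Affine (ProdVar dx dw)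
    times E (affine a ts) with nonempty? E
    ... | yes E≢∅ = affine 0# ((a , z E E≢∅) ∷ map (λ (b , j) → (b , zw E j)) ts)
    ... | no  _   = affine a (map (λ (b , j) → (b , zw E j)) ts)

    eval-times : ∀ E h (v : Point dx dw) →
                 eval (times E h) (mixedProducts v) ≈ ∏ E v * eval h (v ∘ w)
    eval-times E (affine a ts) v = begin
      eval (times E (affine a ts)) (mixedProducts v)
        ≈⟨ split ⟩
      ∏ E v * a + linear (map (λ (b , j) → (b , zw E j)) ts) (mixedProducts v)
        ≈⟨ +-congˡ (linear-reindex (∏ E v) _ (λ b j → x∙yz≈y∙xz b (∏ E v) (v (w j))) ts) ⟩
      ∏ E v * a + ∏ E v * linear ts (v ∘ w)
        ≈⟨ distribˡ (∏ E v) _ _ ⟨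
      ∏ E v * (a + linear ts (v ∘ w))
        ≈⟨ *-congˡ (eval-linear (affine a ts) (v ∘ w)) ⟨
      ∏ E v * eval (affine a ts) (v ∘ w) ∎
      where
      split : eval (times E (affine a ts)) (mixedProducts v) ≈
              ∏ E v * a + linear (map (λ (b , j) → (b , zw E j)) ts) (mixedProducts v)
      split with nonempty? E
      ... | yes ne  = trans (linear-∷ a (z E ne) (map (λ (b , j) → (b , zw E j)) ts) (mixedProducts v)) (+-congʳ (*-comm a (∏ E v)))
      -- For empty `E` the product is 1, so the bare constant `a` agrees with `∏ E v * a`.
      ... | no  E-∅ = trans (eval-linear (affine a (map (λ (b , j) → (b , zw E j)) ts)) (mixedProducts v))
        (+-congʳ (sym (trans (*-congʳ (monomial-empty E (v ∘ x) E-∅)) (*-identityˡ a))))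

    -- With t = x₀, the coordinate split off in each step, this is the expansion
    -- φ(t , ·) = t (φ(1 , ·) - φ(0 , ·)) + φ(0 , ·); k records the coordinates
    -- already chosen.
    interpolate : ∀ {n} → (Vec Bool n → Affine (Fin dw)) → (Subset n → Subset dx) → Affine (ProdVar dx dw)
    interpolate {zero}  φ k = times (k []) (φ [])
    interpolate {suc n} φ k =
      (interpolate (φ ∘ (true ∷_)) (k ∘ (true ∷_)) ⊕ ((- 1#) ⊛ interpolate (φ ∘ (false ∷_)) (k ∘ (true ∷_))))
      ⊕ interpolate (φ ∘ (false ∷_)) (k ∘ (false ∷_))

    -- `π` is the product of the coordinates that `k` has already put into the monomial. Prepending
    -- `true` multiplies it by the next coordinate, prepending `false` leaves it alone. Since the
    -- remaining coordinates are bits, each step retains just the branch of `φ` that agrees with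
    -- `x′`.
    eval-interpolate :
      ∀ {n} (φ : Vec Bool n → Affine (Fin dw)) (k : Subset n → Subset dx) (v : Point dx dw)
        (π : Carrier) (t : Fin n → Carrier) (x′ : Vec Bool n) →
      (∀ i → t i ≈ bit (lookup x′ i)) →
      (∀ E → ∏ (k E) v ≈ π * monomial E t) →
      eval (interpolate φ k) (mixedProducts v) ≈ π * eval (φ x′) (v ∘ w)
    eval-interpolate φ k v π t [] t≈ ∏≈ =
      trans (eval-times (k []) (φ []) v) (*-congʳ (trans (∏≈ []) (*-identityʳ π)))
    eval-interpolate {suc n} φ k v π t (b ∷ x′) t≈ ∏≈ = begin
      eval (interpolate φ k) s
        ≈⟨ eval-⊕ (I₁ ⊕ ((- 1#) ⊛ J₁)) J₀ s ⟩
      eval (I₁ ⊕ ((- 1#) ⊛ J₁)) s + eval J₀ s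
        ≈⟨ +-congʳ (trans (eval-⊕ I₁ ((- 1#) ⊛ J₁) s) (+-congˡ (trans (eval-⊛ (- 1#) J₁ s) (-1*x≈-x _)))) ⟩
      (eval I₁ s - eval J₁ s) + eval J₀ s
        ≈⟨ +-cong (+-cong (IH₁ (φ ∘ (true ∷_))) (-‿cong (IH₁ (φ ∘ (false ∷_))))) IH₀ ⟩
      (π * t₀ * φ[ true ] - π * t₀ * φ[ false ]) + π * φ[ false ]
        ≈⟨ collapse b (t≈ zero) ⟩
      π * φ[ b ] ∎
      where
      s = mixedProducts v
      t₀ = t zero
      I₁ = interpolate (φ ∘ (true ∷_)) (k ∘ (true ∷_))
      J₁ = interpolate (φ ∘ (false ∷_)) (k ∘ (true ∷_))
      J₀ = interpolate (φ ∘ (false ∷_)) (k ∘ (false ∷_))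
      φ[_] : Bool → Carrier
      φ[ b ] = eval (φ (b ∷ x′)) (v ∘ w)
      IH₁ : ∀ ψ → eval (interpolate ψ (k ∘ (true ∷_))) s ≈ π * t₀ * eval (ψ x′) (v ∘ w)
      IH₁ ψ = eval-interpolate ψ (k ∘ (true ∷_)) v (π * t₀) (t ∘ suc) x′ (t≈ ∘ suc)
        (λ E → trans (∏≈ (true ∷ E)) (sym (*-assoc π t₀ _)))
      IH₀ : eval J₀ s ≈ π * φ[ false ]
      IH₀ = eval-interpolate (φ ∘ (false ∷_)) (k ∘ (false ∷_)) v π (t ∘ suc) x′ (t≈ ∘ suc)
        (λ E → trans (∏≈ (false ∷ E)) (*-congˡ (*-identityˡ _)))
      -- At `t₀ = 1` the two `false` terms cancel; at `t₀ = 0` the bracket vanishes.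
      collapse : ∀ b → t₀ ≈ bit b →
                 (π * t₀ * φ[ true ] - π * t₀ * φ[ false ]) + π * φ[ false ] ≈ π * φ[ b ]
      collapse true t₀≈1 = begin
        (π * t₀ * φ[ true ] - π * t₀ * φ[ false ]) + π * φ[ false ]
          ≈⟨ +-congʳ (+-cong (*-congʳ πt₀≈π) (-‿cong (*-congʳ πt₀≈π))) ⟩
        (π * φ[ true ] - π * φ[ false ]) + π * φ[ false ]
          ≈⟨ //-rightDividesˡ _ _ ⟩
        π * φ[ true ] ∎
        where
        πt₀≈π : π * t₀ ≈ π
        πt₀≈π = trans (*-congˡ t₀≈1) (*-identityʳ π)
      collapse false t₀≈0 = begin
        (π * t₀ * φ[ true ] - π * t₀ * φ[ false ]) + π * φ[ false ]
          ≈⟨ +-congʳ (+-cong (vanish _) (-‿cong (vanish _))) ⟩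
        (0# - 0#) + π * φ[ false ]
          ≈⟨ +-congʳ (-‿inverseʳ 0#) ⟩
        0# + π * φ[ false ]
          ≈⟨ +-identityˡ _ ⟩
        π * φ[ false ] ∎
        where
        vanish : ∀ a → π * t₀ * a ≈ 0#
        vanish a = trans (*-congʳ (trans (*-congˡ t₀≈0) (zeroʳ π))) (zeroˡ a)

  -- Translation

  -- A single point with weight 1; this makes the generators of a hull members of it.
  ∈-conv : ∀ {m} (M : Pred (Assignment V) m) {v} → v ∈ M → v ∈ conv M
  ∈-conv M {v} v∈M =
    1 , (λ _ → 1#) , (λ _ → v) , (λ _ → <.asym 0<1) , +-identityʳ 1# , (λ _ → v∈M) ,
    (λ i → sym (trans (+-identityʳ _) (*-identityˡ _)))

  -- `replace T` sends each original variable to a single product variable, so evaluating at `s`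
  -- leaves the projection unchanged.
  proj-subst⊆ : ∀ {dx dw dy} (Q : LinearSystem (ExtVar dx dw dy)) (T : Substitution dx dw dy) →
                proj origᶻ (T [ Q ]) ⊆ proj orig Q
  proj-subst⊆ Q T (s , s∈TQ , s≈v) =
    (λ i → eval (replace T i) s) , Solutions-subst⁻ (replace T) Q s∈TQ ,
    (λ i → trans (eval-var (origᶻ i) s) (s≈v i))

  module _ {dx dw p m} (P : MixedIntegerPolytope dx dw p m) where

    private module P = MixedIntegerPolytope P

    -- The decomposition comes from `isHull`, whose generators are integral, so their mixed products
    -- lie in `D`. On the original variables the mixed products return the point itself, so the
    -- combination projects correctly.
    relaxation : ∀ {D : LinearSystem (ProdVar dx dw)} →
                 (∀ (a : MixedIntegerPoint P) → mixedProducts (point a) ∈ Solutions D) →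
                 IsExtendedRelaxation origᶻ D (points P)
    relaxation {D} f∈D {v} v∈P with proj₁ P.isHull v∈P
    ... | n , coeff , pt , coeff≥0 , sum≈1 , pt∈M , v≈ =
      combination coeff (mixedProducts ∘ pt) ,
      Solutions-convex D coeff≥0 sum≈1 (λ k → f∈D (vertex k)) ,
      (λ i → trans (sum-cong-≋ (λ k → *-congˡ (mixedProducts-orig (pt k) i))) (sym (v≈ i)))
      where
      vertex : Fin n → MixedIntegerPoint P
      vertex k = record
        { point          = pt k
        ; isMember       = proj₂ P.isHull (∈-conv P.generators (pt∈M k))
        ; isMixedInteger = P.integral (pt∈M k)
        }

    sectionSubstitution : ∀ {dy} (g : MixedIntegerPoint P → Assignment (ExtVar dx dw dy)) →
                          IsMixedLinear P g → Substitution dx dw dy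
    -- `id` records that no coordinate has been chosen yet.
    sectionSubstitution g h i = interpolate (λ x′ → proj₁ (h x′ i)) id

    mixedProducts∈subst : ∀ {dy} (Q : LinearSystem (ExtVar dx dw dy))
                          (g : MixedIntegerPoint P → Assignment (ExtVar dx dw dy)) →
                          IsSection P Q g → (h : IsMixedLinear P g) →
                          ∀ a → mixedProducts (point a) ∈ Solutions (sectionSubstitution g h [ Q ])
    mixedProducts∈subst Q g g-section h a =
      -- The section point `g a` already solves `Q`; by `g≈` it agrees in every coordinate with the
      -- values substituted at `f`.
      Solutions-subst⁺ (replace T) Q (Solutions-resp-≈ Q g≈ (proj₁ (g-section a)))
      where
      T = sectionSubstitution g h
      f = mixedProducts (point a)
      x′ = proj₁ (isMixedInteger a)
      x≈x′ = proj₂ (isMixedInteger a)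
      g≈ : ∀ i → g a i ≈ eval (replace T i) f
      g≈ (orig i) = trans (proj₂ (g-section a) i)
        (sym (trans (eval-var (origᶻ i) f) (mixedProducts-orig (point a) i)))
      g≈ (y i) = trans (proj₂ (h x′ i) a x≈x′) (sym (trans
        -- `π` starts as the empty product 1, and the integer part of `a` selects the affine
        -- function that describes the section there.
        (eval-interpolate (λ x″ → proj₁ (h x″ i)) id (point a) 1# (point a ∘ x) x′ x≈x′
          (λ _ → sym (*-identityˡ _)))
        (*-identityˡ _)))

theorem3p2 : ∀ {c ℓ₁ ℓ₂ ℓ₃ p m o : Level} (ℝ : RealField c ℓ₁ ℓ₂ ℓ₃) →
    let open Over ℝ in
    (dx dw dy : ℕ) (P : MixedIntegerPolytope dx dw p m)
    (sense : Sense) (O : Pred (Point dx dw) o) (ρ : Carrier) (1≤ρ : 1# ≤ ρ)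
    (Q : LinearSystem (ExtVar dx dw dy)) →
    IsApproximateExtendedFormulation sense O ρ 1≤ρ Q (points P) →
    HasMixedLinearSection P Q →
    Σ[ T ∈ Substitution dx dw dy ]
    IsTranslation T Q P ×
    (points P ⊆ proj origᶻ (T [ Q ])) ×
    (proj origᶻ (T [ Q ]) ⊆ proj orig Q)
theorem3p2 ℝ dx dw dy P sense O ρ 1≤ρ Q _ (g , g-section , h) =
  -- Being an extended relaxation is by definition the first inclusion, so `P⊆` serves for both.
  T , (P⊆ , f∈TQ) , P⊆ , proj-subst⊆ ℝ Q T
  where
  open Over ℝ
  T = sectionSubstitution ℝ P g h
  f∈TQ = mixedProducts∈subst ℝ P Q g g-section h
  P⊆ = relaxation ℝ P f∈TQ
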